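{- (ZFC.) Let $F\subseteq\mathsf{Agg}^{\sigma}$ be a set with $|F|\le\mathfrak{c}$. Then the $\sigma$-clone generated by $F$ has cardinality at most $\mathfrak{c}$.
   Context: $\mathfrak{c}=2^{\aleph_0}$; the axiom of choice is assumed. $\omega$ is the first infinite ordinal. For an arity $\alpha$ with $0<\alpha\le\omega$ (a positive integer $n=\{0,\dots,n-1\}$ or $\omega$), an $\alpha$-ary aggregation function is a function $f\colon[0,1]^{\alpha}\to[0,1]$ nondecreasing in each coordinate with $f$ equal to $0$ at the all-zero vector and $1$ at the all-one vector. $\mathsf{Agg}$ is the set of aggregation functions of finite arity, $\mathsf{Agg}^{\omega}$ the set of those of arity $\omega$, and $\mathsf{Agg}^{\sigma}=\mathsf{Agg}\cup\mathsf{Agg}^{\omega}$. For an $\alpha$-ary $f$ and $\beta$-ary functions $g_i$, $i<\alpha$ ($0<\alpha,\beta\le\omega$), the composition $f\circ(g_i:i<\alpha)$ is the $\beta$-ary function $\mathbf{x}\mapsto f((g_i(\mathbf{x}))_{i<\alpha})$. A $\sigma$-clone is a set of functions on $[0,1]$ of arities $\alpha$ with $0<\alpha\le\omega$ that contains all projections $p^{\alpha}_i((x_j)_{j<\alpha})=x_i$ ($i<\alpha$) and is closed under such compositions; the $\sigma$-clone generated by $F$ is the smallest $\sigma$-clone containing $F$. -}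

module Defs where

open import Data.Bool.Base using (Bool)
open import Data.Fin.Base using (Fin)
open import Data.Nat.Base as ℕ using (ℕ; NonZero)
import Data.Nat.Properties as ℕ
open import Data.Product.Base using (Σ; Σ-syntax; ∃-syntax; _×_; _,_; proj₁; proj₂)
open import Data.Rational.Base
  using (ℚ; 0ℚ; 1ℚ; ½; _+_; _-_; -_; _*_; _<_; _≤_; ∣_∣)
import Data.Rational.Properties as ℚ
open import Data.Rational.Solver using (module +-*-Solver)
open import Function.Base using (const)
open import Function.Bundles using (Func; _⟨$⟩_; Injection)
open import Function.Indexed.Relation.Binary.Equality using (≡-setoid)
import Function.Relation.Binary.Setoid.Equality as FuncEq
open import Level using (0ℓ)
open import Relation.Binary.Bundles using (Setoid)
import Relation.Binary.Construct.On as On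
open import Relation.Binary.Core using (REL)
open import Relation.Binary.Definitions using (_Respectsˡ_; _Respectsʳ_)
import Relation.Binary.Indexed.Heterogeneous.Construct.Trivial as Trivial
open import Relation.Binary.PropositionalEquality
  using (_≡_; _≢_; refl; sym; trans; cong; subst; _→-setoid_)
open import Relation.Unary using (Pred; _∈_; _⊆_)

-- Over setoids this is a genuine choice principle: the mere existence of a
-- function between the carriers would be automatic from the Σ-type, but the
-- choice function is required to respect the two equalities.
AxiomOfChoice : Set₁
AxiomOfChoice =
  (A B : Setoid 0ℓ 0ℓ) (R : REL (Setoid.Carrier A) (Setoid.Carrier B) 0ℓ) →
  R Respectsˡ Setoid._≈_ A → R Respectsʳ Setoid._≈_ B →
  (∀ x → ∃[ y ] R x y) →
  Σ[ f ∈ Func A B ] (∀ x → R x (f ⟨$⟩ x))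

-- Real numbers are Cauchy sequences of rationals, with sequences identified
-- (by _≈ℝ_) when their difference tends to zero.

Eventually : Pred ℕ 0ℓ → Set
Eventually P = ∃[ N ] (∀ n → N ℕ.≤ n → P n)

record ℝ : Set where
  field
    seq    : ℕ → ℚ
    cauchy : ∀ ε → 0ℚ < ε →
             ∃[ N ] (∀ m n → N ℕ.≤ m → N ℕ.≤ n → ∣ seq m - seq n ∣ < ε)

open ℝ

infix 4 _≈ℝ_ _≤ℝ_

_≈ℝ_ : ℝ → ℝ → Set
x ≈ℝ y = ∀ ε → 0ℚ < ε → Eventually λ n → ∣ seq x n - seq y n ∣ < ε

_≤ℝ_ : ℝ → ℝ → Set
x ≤ℝ y = ∀ ε → 0ℚ < ε → Eventually λ n → seq x n ≤ seq y n + ε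

private
  open +-*-Solver using (solve; _:+_; _:-_; :-_; _:=_)

  ∣p-p∣<ε : ∀ p {ε} → 0ℚ < ε → ∣ p - p ∣ < ε
  ∣p-p∣<ε p {ε} = subst (λ q → ∣ q ∣ < ε) (sym (ℚ.+-inverseʳ p))

  ∣p-q∣≡∣q-p∣ : ∀ p q → ∣ p - q ∣ ≡ ∣ q - p ∣
  ∣p-q∣≡∣q-p∣ p q = trans (cong ∣_∣ (lemma p q)) (ℚ.∣-p∣≡∣p∣ (q - p))
    where
    lemma : ∀ p q → p - q ≡ - (q - p)
    lemma = solve 2 (λ p q → p :- q := :- (q :- p)) refl

  triangle : ∀ p q r → ∣ p - r ∣ ≤ ∣ p - q ∣ + ∣ q - r ∣
  triangle p q r = subst (λ s → ∣ s ∣ ≤ ∣ p - q ∣ + ∣ q - r ∣) (lemma p q r)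
                         (ℚ.∣p+q∣≤∣p∣+∣q∣ (p - q) (q - r))
    where
    lemma : ∀ p q r → (p - q) + (q - r) ≡ p - r
    lemma = solve 3 (λ p q r → (p :- q) :+ (q :- r) := p :- r) refl

  half-pos : ∀ {ε} → 0ℚ < ε → 0ℚ < ½ * ε
  half-pos {ε} = ℚ.*-monoʳ-<-pos ½ {0ℚ} {ε}

  half+half : ∀ ε → ½ * ε + ½ * ε ≡ ε
  half+half ε = trans (sym (ℚ.*-distribʳ-+ ε ½ ½)) (ℚ.*-identityˡ ε)

ℝ-setoid : Setoid 0ℓ 0ℓ
ℝ-setoid = record
  { Carrier       = ℝ
  ; _≈_           = _≈ℝ_
  ; isEquivalence = record
    { refl  = λ {x} ε ε>0 → 0 , λ n _ → ∣p-p∣<ε (seq x n) ε>0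
    ; sym   = λ {x} {y} x≈y ε ε>0 → let N , close = x≈y ε ε>0 in
              N , λ n N≤n → subst (_< ε) (∣p-q∣≡∣q-p∣ (seq x n) (seq y n)) (close n N≤n)
    ; trans = λ {x} {y} {z} x≈y y≈z ε ε>0 →
              let M , close₁ = x≈y (½ * ε) (half-pos ε>0)
                  N , close₂ = y≈z (½ * ε) (half-pos ε>0)
              in M ℕ.⊔ N , λ n M⊔N≤n →
                 ℚ.≤-<-trans (triangle (seq x n) (seq y n) (seq z n))
                   (subst (∣ seq x n - seq y n ∣ + ∣ seq y n - seq z n ∣ <_) (half+half ε)
                     (ℚ.+-mono-< (close₁ n (ℕ.≤-trans (ℕ.m≤m⊔n M N) M⊔N≤n))
                                 (close₂ n (ℕ.≤-trans (ℕ.m≤n⊔m M N) M⊔N≤n))))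
    }
  }

fromℚ : ℚ → ℝ
fromℚ p = record
  { seq    = const p
  ; cauchy = λ ε ε>0 → 0 , λ _ _ _ _ → ∣p-p∣<ε p ε>0
  }

fromℚ-mono : ∀ {p q} → p ≤ q → fromℚ p ≤ℝ fromℚ q
fromℚ-mono {p} {q} p≤q ε ε>0 = 0 , λ _ _ →
  subst (_≤ q + ε) (ℚ.+-identityʳ p) (ℚ.+-mono-≤ p≤q (ℚ.<⇒≤ ε>0))

[0,1] : Set
[0,1] = Σ[ x ∈ ℝ ] (fromℚ 0ℚ ≤ℝ x × x ≤ℝ fromℚ 1ℚ)

[0,1]-setoid : Setoid 0ℓ 0ℓ
[0,1]-setoid = On.setoid ℝ-setoid (proj₁ {B = λ x → fromℚ 0ℚ ≤ℝ x × x ≤ℝ fromℚ 1ℚ})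

open Setoid [0,1]-setoid public using () renaming (_≈_ to _≈ᵢ_)

infix 4 _≤ᵢ_

_≤ᵢ_ : [0,1] → [0,1] → Set
x ≤ᵢ y = proj₁ x ≤ℝ proj₁ y

0ᵢ 1ᵢ : [0,1]
0ᵢ = fromℚ 0ℚ , fromℚ-mono ℚ.≤-refl , fromℚ-mono (ℚ.nonNegative⁻¹ 1ℚ)
1ᵢ = fromℚ 1ℚ , fromℚ-mono (ℚ.nonNegative⁻¹ 1ℚ) , fromℚ-mono ℚ.≤-refl

data Arity : Set where
  fin : (n : ℕ) .{{_ : NonZero n}} → Arity
  ω   : Arity

Coord : Arity → Set
Coord (fin n) = Fin n
Coord ω       = ℕ

[0,1]^_ : Arity → Setoid 0ℓ 0ℓ
[0,1]^ α = ≡-setoid (Coord α) (Trivial.indexedSetoid [0,1]-setoid)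

Op : Arity → Set
Op α = Func ([0,1]^ α) [0,1]-setoid

infix 4 _≈ₒ_

_≈ₒ_ : ∀ {α} → Op α → Op α → Set
_≈ₒ_ {α} = FuncEq._≈_ ([0,1]^ α) [0,1]-setoid

proj : ∀ α → Coord α → Op α
proj α i = record { to = λ x → x i ; cong = λ x≈y → x≈y i }

compose : ∀ {α β} → Op α → (Coord α → Op β) → Op β
compose f g = record
  { to   = λ x → f ⟨$⟩ (λ i → g i ⟨$⟩ x)
  ; cong = λ x≈y → Func.cong f (λ i → Func.cong (g i) x≈y)
  }

AnyOp : Set
AnyOp = Σ[ α ∈ Arity ] Op α

infix 4 _≋_

-- Operations of different arities are never identified.
data _≋_ : AnyOp → AnyOp → Set where
  same : ∀ {α} {f g : Op α} → f ≈ₒ g → (α , f) ≋ (α , g)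

AnyOp-setoid : Setoid 0ℓ 0ℓ
AnyOp-setoid = record
  { Carrier       = AnyOp
  ; _≈_           = _≋_
  ; isEquivalence = record
    { refl  = λ {(α , f)} → same (Setoid.refl (Ops α) {f})
    ; sym   = λ { (same {α} {f} {g} p) → same (Setoid.sym (Ops α) {f} {g} p) }
    ; trans = λ { (same {α} {f} {g} p) (same {g = h} q) →
                  same (Setoid.trans (Ops α) {f} {g} {h} p q) }
    }
  }
  where
  Ops : Arity → Setoid 0ℓ 0ℓ
  Ops α = FuncEq.setoid ([0,1]^ α) [0,1]-setoid

record OpSet : Set₁ where
  field
    member : Pred AnyOp 0ℓ
    resp   : ∀ {f g} → f ≋ g → member f → member g

open OpSet public using (member)

-- Monotonicity is one coordinate at a time; for arity ω this is weaker than
-- monotonicity with respect to the product order.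
NondecreasingInEachCoordinate : ∀ {α} → Op α → Set
NondecreasingInEachCoordinate {α} f =
  ∀ (i : Coord α) (x y : Coord α → [0,1]) →
  (∀ j → j ≢ i → x j ≈ᵢ y j) → x i ≤ᵢ y i → f ⟨$⟩ x ≤ᵢ f ⟨$⟩ y

record IsAggregation {α} (f : Op α) : Set where
  field
    nondecreasing : NondecreasingInEachCoordinate f
    at-zero       : f ⟨$⟩ const 0ᵢ ≈ᵢ 0ᵢ
    at-one        : f ⟨$⟩ const 1ᵢ ≈ᵢ 1ᵢ

Aggσ : Pred AnyOp 0ℓ
Aggσ (_ , f) = IsAggregation f

record IsσClone (C : OpSet) : Set where
  field
    projections : ∀ α i → (α , proj α i) ∈ member C
    composition : ∀ {α β} (f : Op α) (g : Coord α → Op β) →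
                  (α , f) ∈ member C → (∀ i → (β , g i) ∈ member C) →
                  (β , compose f g) ∈ member C

record IsσCloneGeneratedBy (F C : OpSet) : Set₁ where
  field
    isσClone : IsσClone C
    contains : member F ⊆ member C
    least    : ∀ D → IsσClone D → member F ⊆ member D → member C ⊆ member D

-- Used only to show that a smallest σ-clone exists, so that assuming
-- IsσCloneGeneratedBy F C is never vacuous.
data Closure (F : OpSet) : Pred AnyOp 0ℓ where
  gen  : ∀ {f} → f ∈ member F → f ∈ Closure F
  prj  : ∀ α i → (α , proj α i) ∈ Closure F
  comp : ∀ {α β} (f : Op α) (g : Coord α → Op β) →
         (α , f) ∈ Closure F → (∀ i → (β , g i) ∈ Closure F) →
         (β , compose f g) ∈ Closure F
  resp : ∀ {f g} → f ≋ g → f ∈ Closure F → g ∈ Closure F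

generatedσCloneExists : ∀ F → ∃[ C ] IsσCloneGeneratedBy F C
generatedσCloneExists F = record { member = Closure F ; resp = resp } , record
  { isσClone = record { projections = prj ; composition = comp }
  ; contains = gen
  ; least    = least
  }
  where
  least : ∀ D → IsσClone D → member F ⊆ member D → Closure F ⊆ member D
  least D isD F⊆D = go
    where
    go : Closure F ⊆ member D
    go (gen f∈F)      = F⊆D f∈F
    go (prj α i)      = IsσClone.projections isD α i
    go (comp f g p q) = IsσClone.composition isD f g (go p) (λ i → go (q i))
    go (resp f≋g p)   = OpSet.resp D f≋g (go p)

toSetoid : OpSet → Setoid 0ℓ 0ℓ
toSetoid F = On.setoid AnyOp-setoid (proj₁ {B = member F})

-- Injective up to _≋_, so each function is counted once however it is presented.
∣_∣≤𝔠 : OpSet → Set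
∣ F ∣≤𝔠 = Injection (toSetoid F) (ℕ →-setoid Bool)

{-# OPTIONS --safe #-}

-- A member of the clone is given by a well-founded term whose nodes have at
-- most countably many children and whose leaves are projections or elements of
-- F. As 𝔠^ω = 𝔠, such a term is coded by a single element of 2^ω, and the code
-- determines the operation. Choice selects one code per operation.
module Submission where

open import Defs
open import Axiom.ExcludedMiddle using (ExcludedMiddle)
open import Level using (0ℓ)
open import Relation.Unary using (_⊆_)

open import Data.Bool.Base using (Bool; T)
open import Data.Fin.Base using (toℕ)
open import Data.Fin.Properties using (toℕ-injective; toℕ<n; toℕ-fromℕ<)
open import Data.Nat.Base using (ℕ; zero; suc; _+_; _≡ᵇ_)
open import Data.Nat.DivMod using (_mod_; m%n<n; m<n⇒m%n≡m)
open import Data.Nat.Properties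
  using (+-identityʳ; +-suc; suc-injective; ≡⇒≡ᵇ; ≡ᵇ⇒≡)
open import Data.Product.Base using (∃-syntax; _×_; _,_; proj₂; uncurry)
open import Function.Base using (_∘_; id; const)
open import Function.Bundles using (Func; _⟨$⟩_; Injection)
open import Relation.Binary.Bundles using (Setoid)
open import Relation.Binary.PropositionalEquality
  using (_≡_; _≗_; _→-setoid_; refl; sym; trans; cong; subst)
open import Relation.Nullary.Negation using (contradiction)

open Setoid AnyOp-setoid using () renaming (refl to ≋-refl; sym to ≋-sym; trans to ≋-trans)

-- Walks down one antidiagonal and, at its end, jumps to the start of the next.
diagonalStep : ℕ × ℕ → ℕ × ℕ
diagonalStep (zero  , n) = suc n , zero
diagonalStep (suc k , n) = k , suc n

unpair : ℕ → ℕ × ℕ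
unpair zero    = zero , zero
unpair (suc m) = diagonalStep (unpair m)

-- Induction on the diagonal `k + n`, then on `n`: the walk reaches `(k , suc n)` right after
-- `(suc k , n)`, and `(suc k , 0)` right after `(0 , k)`.
unpair-surjective : ∀ k n → ∃[ m ] unpair m ≡ (k , n)
unpair-surjective k n = onDiagonal (k + n) k n refl
  where
  onDiagonal : ∀ s k n → k + n ≡ s → ∃[ m ] unpair m ≡ (k , n)
  onDiagonal s k (suc n) k+1+n≡s =
    let m , eq = onDiagonal s (suc k) n (trans (sym (+-suc k n)) k+1+n≡s)
    in suc m , cong diagonalStep eq
  onDiagonal s zero zero _ = zero , refl
  onDiagonal (suc s) (suc k) zero k+1≡s+1 =
    let m , eq = onDiagonal s zero k (trans (sym (+-identityʳ k)) (suc-injective k+1≡s+1))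
    in suc m , cong diagonalStep eq

Code : Set
Code = ℕ → Bool

-- numeral and node are opaque so that their arguments can be inferred from codes.
opaque
  numeral : ℕ → Code
  numeral = _≡ᵇ_

  numeral-injective : ∀ {k l} → numeral k ≗ numeral l → k ≡ l
  numeral-injective {k} {l} eq = sym (≡ᵇ⇒≡ l k (subst T (eq k) (≡⇒≡ᵇ k k refl)))

infixr 5 _◂_

_◂_ : Code → (ℕ → Code) → (ℕ → Code)
(x ◂ y) zero    = x
(x ◂ y) (suc n) = y n

flatten : (ℕ → Code) → Code
flatten r = uncurry r ∘ unpair

-- Every entry of the array occurs somewhere in the flattened sequence, since `unpair` is onto.
flatten-injective : ∀ {r s} → flatten r ≗ flatten s → ∀ k → r k ≗ s k
flatten-injective {r} {s} eq k n =
  let m , unpair-m = unpair-surjective k n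
  in subst (λ p → uncurry r p ≡ uncurry s p) unpair-m (eq m)

opaque
  node : ℕ → (ℕ → Code) → Code
  node k r = flatten (numeral k ◂ r)

  -- Row 0 of the flattened array holds the label, row `suc n` the child `n`.
  node-label : ∀ {k l r s} → node k r ≗ node l s → k ≡ l
  node-label {k} {l} {r} {s} eq =
    numeral-injective (flatten-injective {numeral k ◂ r} {numeral l ◂ s} eq 0)

  node-children : ∀ {k l r s} → node k r ≗ node l s → ∀ n → r n ≗ s n
  node-children {k} {l} {r} {s} eq n =
    flatten-injective {numeral k ◂ r} {numeral l ◂ s} eq (suc n)

-- Finite arities are positive, which leaves 0 free for `ω`.
arityNumber : Arity → ℕ
arityNumber (fin n) = n
arityNumber ω       = 0

arityNumber-injective : ∀ {α β} → arityNumber α ≡ arityNumber β → α ≡ β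
arityNumber-injective {fin _}       {fin _}       refl = refl
arityNumber-injective {fin (suc _)} {ω}           ()
arityNumber-injective {ω}           {fin (suc _)} ()
arityNumber-injective {ω}           {ω}           _    = refl

index : ∀ α → Coord α → ℕ
index (fin _) = toℕ
index ω       = id

coord : ∀ α → ℕ → Coord α
coord (fin n) k = k mod n
coord ω       k = k

-- Ensures that a family indexed by ℕ through `coord` reaches every coordinate: reduction modulo `n`
-- fixes the numbers below `n`.
coord-index : ∀ α i → coord α (index α i) ≡ i
coord-index (fin n) i = toℕ-injective
  (trans (toℕ-fromℕ< (m%n<n (toℕ i) n)) (m<n⇒m%n≡m (toℕ<n i)))
coord-index ω       i = refl

index-injective : ∀ α {i j} → index α i ≡ index α j → i ≡ j
index-injective α {i} {j} eq =
  trans (sym (coord-index α i)) (trans (cong (coord α) eq) (coord-index α j))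

≋⇒≈ₒ : ∀ {α} {f g : Op α} → (α , f) ≋ (α , g) → f ≈ₒ g
≋⇒≈ₒ (same f≈g) = f≈g

compose-cong : ∀ {α β} {f f′ : Op α} {g g′ : Coord α → Op β} →
               f ≈ₒ f′ → (∀ i → g i ≈ₒ g′ i) → compose f g ≈ₒ compose f′ g′
compose-cong {f = f} {f′} {g} {g′} f≈f′ g≈g′ x =
  Setoid.trans [0,1]-setoid
    {f ⟨$⟩ (λ i → g i ⟨$⟩ x)} {f′ ⟨$⟩ (λ i → g i ⟨$⟩ x)} {f′ ⟨$⟩ (λ i → g′ i ⟨$⟩ x)}
    (f≈f′ _) (Func.cong f′ (λ i → g≈g′ i x))

≋⇒≡ : ∀ {α β} {f : Op α} {g : Op β} → (α , f) ≋ (β , g) → α ≡ β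
≋⇒≡ (same _) = refl

proj-cong : ∀ {α β i j} → α ≡ β → index α i ≡ index β j → (α , proj α i) ≋ (β , proj β j)
proj-cong {α} {i = i} refl eq = subst (λ j → (α , proj α i) ≋ (α , proj α j))
                                      (index-injective α eq) ≋-refl

compose-≋ : ∀ {α α′ β β′} {f : Op α} {f′ : Op α′} {g : Coord α → Op β} {g′ : Coord α′ → Op β′} →
            (α , f) ≋ (α′ , f′) →
            (∀ n → (β , g (coord α n)) ≋ (β′ , g′ (coord α′ n))) →
            (β , compose f g) ≋ (β′ , compose f′ g′)
-- Child 0 always exists and fixes the inner arity. The two arities must be unified before the inner
-- operations can be compared by `≈ₒ`.
compose-≋ f≋f′ g≋g′ = sameArity (≋⇒≡ (g≋g′ 0)) f≋f′ g≋g′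
  where
  sameArity : ∀ {α α′ β β′} {f : Op α} {f′ : Op α′} {g : Coord α → Op β} {g′ : Coord α′ → Op β′} →
              β ≡ β′ → (α , f) ≋ (α′ , f′) →
              (∀ n → (β , g (coord α n)) ≋ (β′ , g′ (coord α′ n))) →
              (β , compose f g) ≋ (β′ , compose f′ g′)
  sameArity {α} {f = f} {f′} {g} {g′} refl (same f≈f′) g≋g′ =
    same (compose-cong {f = f} {f′} {g} {g′} f≈f′ λ i →
      subst (λ j → g j ≈ₒ g′ j) (coord-index α i) (≋⇒≈ₒ (g≋g′ (index α i))))

module _ (F : OpSet) (F≤𝔠 : ∣ F ∣≤𝔠) where

  open Injection F≤𝔠 using () renaming (to to codeF; injective to codeF-injective)

  -- The children y of a composition are indexed by all of ℕ, so for finite α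
  -- each inner operation is repeated periodically.
  data Decodes : Code → AnyOp → Set where
    gen  : ∀ {f} (f∈F : member F f) → Decodes (node 0 (const (codeF (f , f∈F)))) f
    prj  : ∀ α i → Decodes (node (2 + index α i) (const (numeral (arityNumber α))))
                           (α , proj α i)
    comp : ∀ {α β} {f : Op α} {g : Coord α → Op β} {x y} →
           Decodes x (α , f) → (∀ n → Decodes (y n) (β , g (coord α n))) →
           Decodes (node 1 (x ◂ y)) (β , compose f g)
    resp : ∀ {x y f g} → x ≗ y → f ≋ g → Decodes x f → Decodes y g

  -- Induction on both derivations. Once `resp` is stripped, the root labels 0, 1 and at least 2
  -- tell the three kinds of term apart, and equal children are handled recursively. Codes are
  -- compared pointwise, so `x` and `y` need not be the same function.
  decodes-unique : ∀ {x y f g} → Decodes x f → Decodes y g → x ≗ y → f ≋ g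
  decodes-unique (resp x≗x′ f≋f′ d) e x′≗y =
    ≋-trans (≋-sym f≋f′) (decodes-unique d e (λ n → trans (x≗x′ n) (x′≗y n)))
  decodes-unique d (resp y≗y′ g≋g′ e) x≗y′ =
    ≋-trans (decodes-unique d e (λ n → trans (x≗y′ n) (sym (y≗y′ n)))) g≋g′
  decodes-unique (gen _) (gen _) eq =
    -- All children of a leaf are equal, so child 0 carries the whole code.
    codeF-injective (node-children eq 0)
  decodes-unique (prj _ _) (prj _ _) eq =
    -- The child gives the arity; the label less 2 gives the index.
    proj-cong (arityNumber-injective (numeral-injective (node-children eq 0)))
              (suc-injective (suc-injective (node-label eq)))
  decodes-unique (comp d ds) (comp e es) eq =
    compose-≋ (decodes-unique d e (node-children eq 0))
              (λ n → decodes-unique (ds n) (es n) (node-children eq (suc n)))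
  decodes-unique (gen _)    (prj _ _)  eq = contradiction (node-label eq) λ ()
  decodes-unique (gen _)    (comp _ _) eq = contradiction (node-label eq) λ ()
  decodes-unique (prj _ _)  (gen _)    eq = contradiction (node-label eq) λ ()
  decodes-unique (prj _ _)  (comp _ _) eq = contradiction (node-label eq) λ ()
  decodes-unique (comp _ _) (gen _)    eq = contradiction (node-label eq) λ ()
  decodes-unique (comp _ _) (prj _ _)  eq = contradiction (node-label eq) λ ()

  -- Recursion on the derivation yields a code for each child, and these codes together form the
  -- sequence that `node` flattens.
  closure-decoded : ∀ {f} → Closure F f → ∃[ x ] Decodes x f
  closure-decoded (gen f∈F)      = _ , gen f∈F
  closure-decoded (prj α i)      = _ , prj α i
  closure-decoded (comp {α} f g p q) =
    _ , comp (proj₂ (closure-decoded p)) (λ n → proj₂ (closure-decoded (q (coord α n))))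
  closure-decoded (resp f≋g p)   =
    let x , d = closure-decoded p in x , resp (λ _ → refl) f≋g d

theorem2 : ExcludedMiddle 0ℓ → AxiomOfChoice →
    (F : OpSet) → member F ⊆ Aggσ → ∣ F ∣≤𝔠 →
    (C : OpSet) → IsσCloneGeneratedBy F C → ∣ C ∣≤𝔠
theorem2 _ choice F _ F≤𝔠 C C-generated =
  -- Different derivations may give one operation different codes; the chosen `code` depends on the
  -- operation only up to `≋`. The constructor `resp` makes `Decodes` respect both equalities.
  let code , decodes = choice (toSetoid C) (ℕ →-setoid Bool)
        (λ (f , _) x → Decodes F F≤𝔠 x f)
        (λ f≋g → resp (λ _ → refl) f≋g)
        (λ x≗y → resp x≗y ≋-refl)
        (λ (_ , f∈C) → closure-decoded F F≤𝔠 (C⊆Closure f∈C))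
  in record
    { to        = code ⟨$⟩_
    ; cong      = Func.cong code
    ; injective = λ {f} {g} → decodes-unique F F≤𝔠 (decodes f) (decodes g)
    }
  where
  C⊆Closure : member C ⊆ Closure F
  -- `Closure F` is itself a σ-clone containing `F`, so the minimality of `C` applies to it.
  C⊆Closure =
    let D , D-generated = generatedσCloneExists F
    in IsσCloneGeneratedBy.least C-generated D
         (IsσCloneGeneratedBy.isσClone D-generated)
         (IsσCloneGeneratedBy.contains D-generated)
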